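{- Let $(a_i)$ be a representing sequence with $a_1=k$, let $w$ be the representation word of $(a_i)$, and let $f$ be the $1$-promotion function of $(a_i)$. If $w$ is the Nim sequence of a set $S$ of positive integers that contains $\{1,2,\dots,k-1\}$, then $\varphi_k(w)$ is the Nim sequence of the set $S'=f(S)\cup\{1\}$, where $\varphi_k$ is the morphism from words over $\{0,\dots,k\}$ to words over $\{0,\dots,k+1\}$ given by $\varphi_k(0)=01$ and $\varphi_k(i)=i+1$ for $i>0$.
   Context: A representing sequence is a strictly increasing sequence $(a_i)_{i\ge0}$ of positive integers with $a_0=1$. For $n\ge1$ with $a_j\le n<a_{j+1}$, the $(a_i)$-representation of $n$ is the digit string $d_j\cdots d_0$ with $n=\sum d_ia_i$ and $\sum d_i$ minimal (greedy); the representation of $0$ is the digit $0$. $n\ge0$ is $2$-volatile if the representation of $n+1$ ends in at least two zeros. The representation word of $(a_i)$ is the infinite word $w$ with $w[n]=a_1$ if $n$ is $2$-volatile and otherwise $w[n]$ equals the last digit of the representation of $n$. The $1$-promotion of $(a_i)$ is $(b_i)_{i\ge0}$ with $b_0=1$ and, for $i\ge1$, writing $d_{i-1}\cdots d_0$ for the representation of $a_i-1$: $b_i=1+(d_0+1)b_0+\sum_{\ell=1}^{i-1}d_\ell b_\ell$ if $d_0>0$, else $b_i=1+\sum_{\ell=0}^{i-1}d_\ell b_\ell$. The $1$-promotion function $f$ is defined by $f(0)=0$ and, for $n\ge1$ with representation $d_i d_{i-1}\cdots d_0$: $f(n)=(d_0+1)b_0+\sum_{\ell=1}^{i}d_\ell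 b_\ell$ if $d_0>0$, else $f(n)=\sum_{\ell=0}^{i}d_\ell b_\ell$. For a set $S$ of positive integers, $\mathrm{SG}_S(n)=\mathrm{mex}\{\mathrm{SG}_S(n-s)\mid s\in S,s\le n\}$ and the Nim sequence of $S$ is $(\mathrm{SG}_S(n))_{n\ge0}$. -}

module Defs where

open import Data.Nat using (ℕ; zero; suc; _+_; _*_; _∸_; _≤_; _<_; _≤ᵇ_; _/_; _%_)
open import Data.Bool using (Bool; true; false; if_then_else_)
open import Data.List using (List; []; _∷_; _++_; reverse; map; upTo; zipWith; length)
open import Data.Nat.ListAction using (sum)
open import Data.Product using (_×_; ∃)
open import Data.Sum using (_⊎_)
open import Relation.Nullary using (¬_)
open import Relation.Binary.PropositionalEquality using (_≡_)

RepSeq : (ℕ → ℕ) → Set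
RepSeq a = (a 0 ≡ 1) × (∀ i → a i < a (suc i))

-- division / remainder, total (divisor 0 gives 0 / the number itself; never
-- used for representing sequences, whose terms are positive)
divP : ℕ → ℕ → ℕ
divP m zero = 0
divP m (suc d) = m / suc d

modP : ℕ → ℕ → ℕ
modP m zero = m
modP m (suc d) = m % suc d

nth : List ℕ → ℕ → ℕ
nth [] _ = 0
nth (x ∷ xs) zero = x
nth (x ∷ xs) (suc i) = nth xs i

topFrom : (ℕ → ℕ) → ℕ → ℕ → ℕ
topFrom a n zero = 0
topFrom a n (suc j) = if a (suc j) ≤ᵇ n then suc j else topFrom a n j

-- index j with a_j ≤ n < a_{j+1}  (for n ≥ 1; j ≤ n since a_j > j)
top : (ℕ → ℕ) → ℕ → ℕ
top a n = topFrom a n n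

greedyBE : (ℕ → ℕ) → ℕ → ℕ → List ℕ
greedyBE a zero r = divP r (a 0) ∷ []
greedyBE a (suc i) r = divP r (a (suc i)) ∷ greedyBE a i (modP r (a (suc i)))

-- (a_i)-representation of n, little-endian: d_0 ∷ d_1 ∷ … ∷ d_j ∷ []
-- (for n = 0 this is the single digit 0)
rep : (ℕ → ℕ) → ℕ → List ℕ
rep a n = reverse (greedyBE a (top a n) n)

lastDigit : List ℕ → ℕ
lastDigit [] = 0
lastDigit (d ∷ _) = d

ends00 : List ℕ → Bool
ends00 (zero ∷ zero ∷ _) = true
ends00 _ = false

volatile2 : (ℕ → ℕ) → ℕ → Bool
volatile2 a n = ends00 (rep a (suc n))

repWord : (ℕ → ℕ) → ℕ → ℕ
repWord a n = if volatile2 a n then a 1 else lastDigit (rep a n)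

adj : List ℕ → List ℕ
adj (suc d ∷ ds) = suc (suc d) ∷ ds
adj ds = ds

dot : List ℕ → List ℕ → ℕ
dot ds bs = sum (zipWith _*_ ds bs)

promoList : (ℕ → ℕ) → ℕ → List ℕ
promoList a zero = 1 ∷ []
promoList a (suc i) =
  promoList a i ++ (1 + dot (adj (rep a (a (suc i) ∸ 1))) (promoList a i)) ∷ []

promo : (ℕ → ℕ) → ℕ → ℕ
promo a i = nth (promoList a i) i

promoF : (ℕ → ℕ) → ℕ → ℕ
promoF a zero = 0
promoF a (suc n) = dot (adj (rep a (suc n))) (map (promo a) (upTo (length (rep a (suc n)))))

IsMex : (ℕ → Set) → ℕ → Set
IsMex P m = ¬ P m × (∀ j → j < m → P j)

Options : (ℕ → Set) → (ℕ → ℕ) → ℕ → ℕ → Set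
Options S w n v = ∃ λ s → S s × s ≤ n × w (n ∸ s) ≡ v

IsNimSeq : (ℕ → Set) → (ℕ → ℕ) → Set
IsNimSeq S w = ∀ n → IsMex (Options S w n) (w n)

phiL : List ℕ → List ℕ
phiL [] = []
phiL (zero ∷ xs) = 0 ∷ 1 ∷ phiL xs
phiL (suc i ∷ xs) = suc (suc i) ∷ phiL xs

phiWord : (ℕ → ℕ) → ℕ → ℕ
phiWord w n = nth (phiL (map w (upTo (suc n)))) n

promoSet : (ℕ → ℕ) → (ℕ → Set) → ℕ → Set
promoSet a S x = (x ≡ 1) ⊎ (∃ λ s → S s × promoF a s ≡ x)

{-# OPTIONS --safe #-}
module Submission where

-- Write w for the representation word and f for the 1-promotion function. Incrementing n changes its
-- last digit in one of three ways (it grows by one, it wraps around from k ∸ 1 to 0, or n is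
-- 2-volatile), and in each case f (n + 1) ∸ f n is the length of the image of w n under φₖ. So f n is
-- the position at which the image of the n-th letter starts in φₖ(w), and f n = n + (number of zeros
-- of w before n).
--
-- Since S contains 1, …, k ∸ 1 and w is its Nim sequence, w is a concatenation of ramps 0 1 … (k ∸ 1),
-- some of them followed by a letter k, so consecutive zeros of w are at distance k or k + 1. No element
-- s of S is a difference of two zeros. Hence, when a window [m, m + s) starting at a zero slides to the
-- next zero, one zero leaves it and exactly one enters, which yields f (m + s) = f m + f s for every
-- zero m of w and every s in S. With this the options in φₖ(w) are read off from those in w.

open import Defs
open import Data.Bool using (true; false; T)
open import Data.Nat using (ℕ; zero; suc; _+_; _*_; _∸_; _/_; _%_; _≤_; _<_; _≤ᵇ_; z≤n; s≤s; s≤s⁻¹; _≟_; NonZero)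
open import Data.Nat.Properties
open import Data.Nat.DivMod
open import Data.Nat.Divisibility using (divides-refl)
open import Data.Nat.Induction using (<-rec)
open import Data.List using (List; []; _∷_; _++_; _∷ʳ_; map; upTo; applyUpTo; length; reverse)
open import Data.List.Properties using (map-upTo; applyUpTo-∷ʳ; unfold-reverse; length-++)
open import Data.Product using (∃; ∃₂; _×_; _,_; proj₁; proj₂)
open import Data.Sum using (_⊎_; inj₁; inj₂)
open import Data.Unit using (tt)
open import Function using (_∘_)
open import Relation.Nullary using (¬_; yes; no; contradiction)
open import Relation.Binary.Definitions using (tri<; tri≈; tri>)
open import Relation.Binary.PropositionalEquality using (_≡_; _≢_; refl; sym; trans; cong; cong₂; subst; module ≡-Reasoning)

-- The morphism

imageLength : ℕ → ℕ
imageLength zero    = 2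
imageLength (suc _) = 1

firstLetter : ℕ → ℕ
firstLetter zero    = 0
firstLetter (suc i) = suc (suc i)

firstLetter-injective : ∀ {i j} → firstLetter i ≡ firstLetter j → i ≡ j
firstLetter-injective {zero}  {zero}  _  = refl
firstLetter-injective {suc _} {suc _} eq = suc-injective eq

firstLetter≢1 : ∀ i → firstLetter i ≢ 1
firstLetter≢1 zero    ()
firstLetter≢1 (suc _) ()

start : (ℕ → ℕ) → ℕ → ℕ
start w zero    = 0
start w (suc n) = start w n + imageLength (w n)

n≤start : ∀ w n → n ≤ start w n
n≤start w zero = z≤n
n≤start w (suc n) = subst (_≤ start w (suc n)) (+-comm n 1) (+-mono-≤ (n≤start w n) (1≤imageLength (w n)))
  where
  1≤imageLength : ∀ v → 1 ≤ imageLength v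
  1≤imageLength zero    = s≤s z≤n
  1≤imageLength (suc _) = s≤s z≤n

start-tail : ∀ w n → start w (suc n) ≡ imageLength (w 0) + start (w ∘ suc) n
start-tail w zero = +-comm 0 _
start-tail w (suc n) = trans (cong (_+ imageLength (w (suc n))) (start-tail w n)) (+-assoc (imageLength (w 0)) _ _)

nth-phiL-drop : ∀ w n N j → nth (phiL (applyUpTo w (n + N))) (start w n + j) ≡
                            nth (phiL (applyUpTo (λ i → w (n + i)) N)) j
nth-phiL-drop w zero N j = refl
nth-phiL-drop w (suc n) N j rewrite start-tail w n with w 0
... | zero  = nth-phiL-drop (w ∘ suc) n N j
... | suc _ = nth-phiL-drop (w ∘ suc) n N j

-- At index `x`, `phiWord` applies the morphism only to the first `suc x` letters. Since
-- `n ≤ start w n`, the prefix used at `j + start w n` still contains letter `n`, which heads the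
-- `suc N` letters left after dropping `n` of them.
phiWord-drop : ∀ w n j → ∃ λ N → phiWord w (j + start w n) ≡
                                 nth (phiL (applyUpTo (λ i → w (n + i)) (suc N))) j
phiWord-drop w n j with m≤n⇒∃[o]m+o≡n (≤-trans (n≤start w n) (m≤n+m (start w n) j))
... | N , eq = N , (begin
  nth (phiL (map w (upTo (suc x)))) x
    ≡⟨ cong (λ ws → nth (phiL ws) x) (map-upTo w (suc x)) ⟩
  nth (phiL (applyUpTo w (suc x))) x
    ≡⟨ cong (λ l → nth (phiL (applyUpTo w l)) x) (trans (cong suc (sym eq)) (sym (+-suc n N))) ⟩
  nth (phiL (applyUpTo w (n + suc N))) x
    ≡⟨ cong (nth (phiL (applyUpTo w (n + suc N)))) (+-comm j (start w n)) ⟩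
  nth (phiL (applyUpTo w (n + suc N))) (start w n + j)
    ≡⟨ nth-phiL-drop w n (suc N) j ⟩
  nth (phiL (applyUpTo (λ i → w (n + i)) (suc N))) j
    ∎)
  where
  open ≡-Reasoning
  x = j + start w n

phiWord-start : ∀ w n → phiWord w (start w n) ≡ firstLetter (w n)
phiWord-start w n with phiWord-drop w n 0
... | N , eq rewrite +-identityʳ n with w n
...   | zero  = eq
...   | suc _ = eq

phiWord-start-zero : ∀ w n → w n ≡ 0 → phiWord w (start w n) ≡ 0
phiWord-start-zero w n wn = trans (phiWord-start w n) (cong firstLetter wn)

phiWord-start-suc : ∀ w n v → w n ≡ suc v → phiWord w (start w n) ≡ suc (suc v)
phiWord-start-suc w n v wn = trans (phiWord-start w n) (cong firstLetter wn)

phiWord-suc-start-zero : ∀ w n → w n ≡ 0 → phiWord w (suc (start w n)) ≡ 1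
phiWord-suc-start-zero w n wn with phiWord-drop w n 1
... | N , eq rewrite +-identityʳ n | wn = eq

data Position (w : ℕ → ℕ) : ℕ → Set where
  first  : ∀ n → Position w (start w n)
  second : ∀ n → w n ≡ 0 → Position w (suc (start w n))

start-suc-zero : ∀ w n → w n ≡ 0 → start w (suc n) ≡ suc (suc (start w n))
start-suc-zero w n eq rewrite eq = +-comm (start w n) 2

start-suc-nonzero : ∀ w n → w n ≢ 0 → start w (suc n) ≡ suc (start w n)
start-suc-nonzero w n neq with w n
... | zero  = contradiction refl neq
... | suc _ = +-comm (start w n) 1

position : ∀ w x → Position w x
position w zero = first 0
position w (suc x) with position w x
... | second n eq = subst (Position w) (start-suc-zero w n eq) (first (suc n))
... | first n with w n ≟ 0
...   | yes eq = second n eq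
...   | no neq = subst (Position w) (start-suc-nonzero w n neq) (first (suc n))

start-mono-< : ∀ w {m n} → m < n → start w m < start w n
start-mono-< w {m} {suc n} (s≤s m≤n) = ≤-trans (s≤s (start-mono-≤ (m≤n⇒m<n∨m≡n m≤n))) (start-suc n)
  where
  start-suc : ∀ n → start w n < start w (suc n)
  start-suc n with w n ≟ 0
  ... | yes eq = subst (start w n <_) (sym (start-suc-zero w n eq)) (m≤n⇒m≤1+n ≤-refl)
  ... | no neq = subst (start w n <_) (sym (start-suc-nonzero w n neq)) ≤-refl
  start-mono-≤ : m < n ⊎ m ≡ n → start w m ≤ start w n
  start-mono-≤ (inj₁ m<n)  = <⇒≤ (start-mono-< w m<n)
  start-mono-≤ (inj₂ refl) = ≤-refl

start-injective : ∀ w {m n} → start w m ≡ start w n → m ≡ n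
start-injective w {m} {n} eq with <-cmp m n
... | tri< m<n _ _ = contradiction eq (<⇒≢ (start-mono-< w m<n))
... | tri≈ _ m≡n _ = m≡n
... | tri> _ _ n<m = contradiction (sym eq) (<⇒≢ (start-mono-< w n<m))

-- Nim sequences whose letters rise in ramps

-- The interface between digits and words: `L n` is to be the last digit of the representation of
-- `n`. Together with `L0≡0` and `L<k`, these cases are all that the analysis of the Nim sequence
-- takes from the numeration.
data Step (k : ℕ) (w L : ℕ → ℕ) (n : ℕ) : Set where
  volatile  : w n ≡ k → L (suc n) ≡ 0 → Step k w L n
  increment : w n ≡ L n → L (suc n) ≡ suc (L n) → Step k w L n
  wrap      : w n ≡ L n → suc (L n) ≡ k → L (suc n) ≡ 0 → Step k w L n

module NimWord (h : ℕ) (w L : ℕ → ℕ) (S : ℕ → Set)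
  (positive : ∀ s → S s → 1 ≤ s) (initial : ∀ i → 1 ≤ i → i < suc (suc h) → S i) (nim : IsNimSeq S w)
  (L0≡0 : L 0 ≡ 0) (L<k : ∀ n → L n < suc (suc h)) (step : ∀ n → Step (suc (suc h)) w L n) where

  private
    k = suc (suc h)
    f = start w
    φ = phiWord w

  -- This is the exclusion half of the mex: `w m` is one of the options at `m + s`.
  w≢-shift : ∀ {s} m → S s → w (m + s) ≢ w m
  w≢-shift {s} m Ss eq = proj₁ (nim (m + s)) (s , Ss , m≤n+m s m , trans (cong w (m+n∸n≡m m s)) (sym eq))

  w≢-suc : ∀ m → w (suc m) ≢ w m
  w≢-suc m = w≢-shift m (initial 1 (s≤s z≤n) (s≤s (s≤s z≤n))) ∘ trans (cong w (+-comm m 1))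

  w0≡0 : w 0 ≡ 0
  w0≡0 with w 0 | proj₂ (nim 0)
  ... | zero  | _ = refl
  ... | suc v | options with options 0 (s≤s z≤n)
  ...   | s , Ss , s≤0 , _ = contradiction (≤-trans (positive s Ss) s≤0) λ ()

  letter : ∀ n → w n ≡ L n ⊎ (w n ≡ k × L (suc n) ≡ 0)
  letter n with step n
  ... | volatile wk L0  = inj₂ (wk , L0)
  ... | increment wL _  = inj₁ wL
  ... | wrap wL _ _     = inj₁ wL

  w<k⇒w≡L : ∀ n → w n < k → w n ≡ L n
  w<k⇒w≡L n w<k with letter n
  ... | inj₁ wL       = wL
  ... | inj₂ (wk , _) = contradiction wk (<⇒≢ w<k)

  w≡k⇒L-suc≡0 : ∀ n → w n ≡ k → L (suc n) ≡ 0
  w≡k⇒L-suc≡0 n wk with letter n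
  ... | inj₁ wL       = contradiction (trans (sym wL) wk) (<⇒≢ (L<k n))
  ... | inj₂ (_ , L0) = L0

  w<k∨w≡k : ∀ n → w n < k ⊎ w n ≡ k
  w<k∨w≡k n with letter n
  ... | inj₁ wL       = inj₁ (subst (_< k) (sym wL) (L<k n))
  ... | inj₂ (wk , _) = inj₂ wk

  zeros-apart : ∀ {z t} → w z ≡ 0 → suc t < k → w (z + suc t) ≢ 0
  zeros-apart {z} {t} wz t<k eq = w≢-shift z (initial (suc t) (s≤s z≤n) t<k) (trans eq (sym wz))

  -- The letter after `k` is the last digit, just reset to 0, or again `k`; the second case is ruled
  -- out because 1 belongs to `S`.
  zero-after-k : ∀ n → w n ≡ k → w (suc n) ≡ 0
  zero-after-k n wk with letter (suc n)
  ... | inj₁ wL        = trans wL (w≡k⇒L-suc≡0 n wk)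
  ... | inj₂ (wk′ , _) = contradiction (trans wk′ (sym wk)) (w≢-suc n)

  L-suc-pred : ∀ n v → L n ≡ suc v → ∃ λ m → n ≡ suc m × w m ≡ v
  L-suc-pred zero v eq = contradiction (trans (sym L0≡0) eq) λ ()
  L-suc-pred (suc m) v eq with step m
  ... | volatile _ L0       = contradiction (trans (sym L0) eq) λ ()
  ... | increment wL Lsuc   = m , refl , trans wL (suc-injective (trans (sym Lsuc) eq))
  ... | wrap _ _ L0         = contradiction (trans (sym L0) eq) λ ()

  Ramp : ℕ → ℕ → Set
  Ramp p v = ∀ i → i ≤ v → w (p + i) ≡ i

  Ramp-zero : ∀ {p v} → Ramp p v → w p ≡ 0
  Ramp-zero {p} ramp = trans (cong w (sym (+-identityʳ p))) (ramp 0 z≤n)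

  -- A positive last digit arises only from an increment, so a letter below `k` can be traced back
  -- step by step to the zero that starts its ramp.
  ramp-down : ∀ v m → w m ≡ v → v < k → ∃ λ p → p + v ≡ m × Ramp p v
  ramp-down zero m wm _ = m , +-identityʳ m , λ { zero z≤n → trans (cong w (+-identityʳ m)) wm }
  ramp-down (suc v) m wm v<k with L-suc-pred m v (trans (sym (w<k⇒w≡L m (subst (_< k) (sym wm) v<k))) wm)
  ... | m′ , refl , wm′ with ramp-down v m′ wm′ (<⇒≤ v<k)
  ...   | p , refl , ramp = p , +-suc p v , ramp′
    where
    ramp′ : Ramp p (suc v)
    ramp′ i i≤ with m≤n⇒m<n∨m≡n i≤
    ... | inj₁ (s≤s i≤v) = ramp i i≤v
    ... | inj₂ refl      = trans (cong w (+-suc p v)) wm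

  -- Here k would be without the option k ∸ 1: the ramp ending in that option and the ramp below k
  -- would both start with 0.
  no-short-ramp : ∀ p v → Ramp p v → suc v < k → w (suc (p + v)) ≢ k
  no-short-ramp p v ramp v+1<k wk with m≤n⇒m<n∨m≡n v+1<k
  ... | inj₁ v+2<k = zeros-apart {p} {suc v} (Ramp-zero ramp) v+2<k
          (trans (cong w (trans (+-suc p (suc v)) (cong suc (+-suc p v)))) (zero-after-k (suc (p + v)) wk))
  ... | inj₂ refl with proj₂ (nim (suc (p + v))) (suc h) (subst (suc h <_) (sym wk) ≤-refl)
  ...   | s , Ss , s≤n , eq with ramp-down (suc h) (suc (p + v) ∸ s) eq ≤-refl
  ...     | q , q+k-1≡n∸s , ramp′ =
            w≢-shift q Ss (trans (cong w q+s≡p) (trans (Ramp-zero ramp) (sym (Ramp-zero ramp′))))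
    where
    open ≡-Reasoning
    q+s≡p : q + s ≡ p
    q+s≡p = +-cancelʳ-≡ (suc h) (q + s) p (begin
      q + s + suc h         ≡⟨ +-assoc q s (suc h) ⟩
      q + (s + suc h)       ≡⟨ cong (q +_) (+-comm s (suc h)) ⟩
      q + (suc h + s)       ≡⟨ sym (+-assoc q (suc h) s) ⟩
      q + suc h + s         ≡⟨ cong (_+ s) q+k-1≡n∸s ⟩
      suc (p + v) ∸ s + s   ≡⟨ m∸n+n≡m s≤n ⟩
      suc (p + v)           ≡⟨ sym (+-suc p v) ⟩
      p + suc h             ∎)

  -- The letter before `k` is not `k`, and `no-short-ramp` excludes a ramp that could still grow.
  -- What remains is the wrap, where the ramp has reached `k ∸ 1`.
  ramp-below-k : ∀ n → w n ≡ k → ∃ λ p → p + k ≡ n × Ramp p (suc h)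
  ramp-below-k zero wk = contradiction (trans (sym w0≡0) wk) λ ()
  ramp-below-k (suc m) wk with step m
  ... | volatile wk′ _ = contradiction (trans wk (sym wk′)) (w≢-suc m)
  ... | wrap wL L≡k-1 _ with ramp-down (suc h) m (trans wL (suc-injective L≡k-1)) ≤-refl
  ...   | p , refl , ramp = p , +-suc p (suc h) , ramp
  ramp-below-k (suc m) wk | increment wL Lsuc with ramp-down (L m) m wL (L<k m)
  ...   | p , eq , ramp = contradiction (trans (cong (w ∘ suc) eq) wk)
            (no-short-ramp p (L m) ramp (subst (_< k) Lsuc (L<k (suc m))))

  -- Counting zeros in windows

  start-after-zero : ∀ z j → w z ≡ 0 → j < k → f (z + suc j) ≡ suc (suc j) + f z
  start-after-zero z zero wz _ = trans (cong f (+-comm z 1)) (start-suc-zero w z wz)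
  start-after-zero z (suc j) wz j<k = begin
    f (z + suc (suc j))     ≡⟨ cong f (+-suc z (suc j)) ⟩
    f (suc (z + suc j))     ≡⟨ start-suc-nonzero w (z + suc j) (zeros-apart wz j<k) ⟩
    suc (f (z + suc j))     ≡⟨ cong suc (start-after-zero z j wz (<⇒≤ j<k)) ⟩
    suc (suc (suc j)) + f z ∎
    where open ≡-Reasoning

  -- Zeros are at least `k` apart, so the zero at `x + i` is the first one from `x` on, and each of
  -- the `i` letters before it has an image of length 1.
  start-before-zero : ∀ i x → w x ≢ 0 → i ≤ k → w (x + i) ≡ 0 → f (x + i) ≡ i + f x
  start-before-zero zero x wx _ eq = contradiction (trans (cong w (sym (+-identityʳ x))) eq) wx
  start-before-zero (suc zero) x wx _ eq = trans (cong f (+-comm x 1)) (start-suc-nonzero w x wx)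
  start-before-zero (suc (suc i)) x wx i<k eq = begin
    f (x + suc (suc i))       ≡⟨ cong f (+-suc x (suc i)) ⟩
    f (suc x + suc i)         ≡⟨ start-before-zero (suc i) (suc x) wsx (<⇒≤ i<k) eq′ ⟩
    suc i + f (suc x)         ≡⟨ cong (suc i +_) (start-suc-nonzero w x wx) ⟩
    suc i + suc (f x)         ≡⟨ +-suc (suc i) (f x) ⟩
    suc (suc i) + f x         ∎
    where
    open ≡-Reasoning
    eq′ : w (suc x + suc i) ≡ 0
    eq′ = trans (cong w (sym (+-suc x (suc i)))) eq
    wsx : w (suc x) ≢ 0
    wsx wz = zeros-apart wz i<k eq′

  -- The ramp that ends at `x + k`, or the full ramp just below a letter `k` standing there, starts
  -- no earlier than `x`.
  zero-in-window : ∀ x → ∃ λ i → i ≤ k × w (x + i) ≡ 0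
  zero-in-window x with w<k∨w≡k (x + k)
  ... | inj₁ v<k with ramp-down (w (x + k)) (x + k) refl v<k
  ...   | p , eq , ramp = k ∸ v , m∸n≤m k v , trans (cong w x+[k∸v]≡p) (Ramp-zero ramp)
    where
    v = w (x + k)
    x+[k∸v]≡p : x + (k ∸ v) ≡ p
    x+[k∸v]≡p = +-cancelʳ-≡ v _ _ (trans (+-assoc x (k ∸ v) v) (trans (cong (x +_) (m∸n+n≡m (<⇒≤ v<k))) (sym eq)))
  zero-in-window x | inj₂ wk with ramp-below-k (x + k) wk
  ...   | p , eq , ramp = 0 , z≤n , trans (cong w (trans (+-identityʳ x) (sym (+-cancelʳ-≡ k p x eq)))) (Ramp-zero ramp)

  Gap : ℕ → Set
  Gap g = g ≡ k ⊎ g ≡ suc k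

  -- The window `[x, x + g)` contains exactly one zero: `zero-in-window` provides one, and fewer
  -- than `k` letters follow it inside the window, too few for a second.
  start-window : ∀ {g} → Gap g → ∀ x → w x ≢ 0 → w (x + g) ≢ 0 → f (x + g) ≡ suc g + f x
  start-window {g} gap x wx wxg with zero-in-window x
  ... | zero , _ , wz = contradiction (trans (cong w (sym (+-identityʳ x))) wz) wx
  ... | suc i , i<k , wz = begin
    f (x + g)                            ≡⟨ cong f x+g≡ ⟩
    f (x + suc i + suc j)                ≡⟨ start-after-zero (x + suc i) j wz j<k ⟩
    suc (suc j) + f (x + suc i)          ≡⟨ cong (suc (suc j) +_) (start-before-zero (suc i) x wx i<k wz) ⟩
    suc (suc j) + (suc i + f x)          ≡⟨ sym (+-assoc (suc (suc j)) (suc i) (f x)) ⟩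
    suc (suc j + suc i) + f x            ≡⟨ cong (λ l → suc l + f x) (trans (+-comm (suc j) (suc i)) split) ⟩
    suc g + f x                          ∎
    where
    open ≡-Reasoning
    -- The zero found must lie strictly before `x + g`; for `g ≡ k` this is where the assumption on
    -- the right end enters.
    i<g : ∀ {g} → Gap g → w (x + g) ≢ 0 → suc i < g
    i<g (inj₁ refl) wxg = ≤∧≢⇒< i<k λ { refl → wxg wz }
    i<g (inj₂ refl) _   = s≤s i<k
    g≤1+k : ∀ {g} → Gap g → g ≤ suc k
    g≤1+k (inj₁ refl) = m≤n⇒m≤1+n ≤-refl
    g≤1+k (inj₂ refl) = ≤-refl
    j = proj₁ (m≤n⇒∃[o]m+o≡n (i<g gap wxg))
    split : suc i + suc j ≡ g
    split = trans (+-suc (suc i) j) (proj₂ (m≤n⇒∃[o]m+o≡n (i<g gap wxg)))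
    x+g≡ : x + g ≡ x + suc i + suc j
    x+g≡ = trans (cong (x +_) (sym split)) (sym (+-assoc x (suc i) (suc j)))
    j<k : j < k
    j<k = ≤-trans (m≤n+m (suc j) i) (s≤s⁻¹ (subst (_≤ suc k) (sym split) (g≤1+k gap)))

  -- A zero follows either a ramp that wraps, at distance `k` from the start of that ramp, or a
  -- letter `k` on top of a full ramp, at distance `suc k`.
  previous-zero : ∀ m → w (suc m) ≡ 0 → ∃₂ λ p g → w p ≡ 0 × Gap g × p + g ≡ suc m × f (p + g) ≡ suc g + f p
  previous-zero m w0 with letter (suc m) | step m
  ... | inj₂ (wk , _) | _ = contradiction (trans (sym wk) w0) λ ()
  ... | inj₁ wL | increment _ Lsuc = contradiction (trans (sym w0) (trans wL Lsuc)) λ ()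
  ... | inj₁ wL | wrap wL′ L≡k-1 _ with ramp-down (suc h) m (trans wL′ (suc-injective L≡k-1)) ≤-refl
  ...   | p , eq , ramp = p , k , Ramp-zero ramp , inj₁ refl , trans (+-suc p (suc h)) (cong suc eq)
                        , start-after-zero p (suc h) (Ramp-zero ramp) ≤-refl
  previous-zero m w0 | inj₁ wL | volatile wk _ with ramp-below-k m wk
  ...   | p , refl , ramp = p , suc k , Ramp-zero ramp , inj₂ refl , +-suc p k , (begin
    f (p + suc k)       ≡⟨ cong f (+-suc p k) ⟩
    f (suc (p + k))     ≡⟨ start-suc-nonzero w (p + k) (λ eq → contradiction (trans (sym eq) wk) λ ()) ⟩
    suc (f (p + k))     ≡⟨ cong suc (start-after-zero p (suc h) (Ramp-zero ramp) ≤-refl) ⟩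
    suc (suc k) + f p   ∎)
    where open ≡-Reasoning

  -- Passing from one zero p of w to the next zero p + g moves the window [p, p + s) past exactly one
  -- zero at its left end; start-window shows that exactly one zero enters on the right.
  start-additive : ∀ {s} → S s → ∀ m → w m ≡ 0 → f (m + s) ≡ f m + f s
  start-additive {s} Ss = <-rec _ go
    where
    open ≡-Reasoning
    nonzero : ∀ p → w p ≡ 0 → w (p + s) ≢ 0
    nonzero p wp eq = w≢-shift p Ss (trans eq (sym wp))
    swap : ∀ p g → p + g + s ≡ p + s + g
    swap p g = trans (+-assoc p g s) (trans (cong (p +_) (+-comm g s)) (sym (+-assoc p s g)))
    go : ∀ m → (∀ {p} → p < m → w p ≡ 0 → f (p + s) ≡ f p + f s) → w m ≡ 0 → f (m + s) ≡ f m + f s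
    go zero _ _ = refl
    go (suc m) ih wm with previous-zero m wm
    ... | p , g , wp , gap , p+g≡m , fp+g = begin
      f (suc m + s)          ≡⟨ cong (λ l → f (l + s)) (sym p+g≡m) ⟩
      f (p + g + s)          ≡⟨ cong f (swap p g) ⟩
      f (p + s + g)          ≡⟨ start-window gap (p + s) (nonzero p wp) wpsg ⟩
      suc g + f (p + s)      ≡⟨ cong (suc g +_) (ih p<m wp) ⟩
      suc g + (f p + f s)    ≡⟨ sym (+-assoc (suc g) (f p) (f s)) ⟩
      suc g + f p + f s      ≡⟨ cong (_+ f s) (sym fp+g) ⟩
      f (p + g) + f s        ≡⟨ cong (λ l → f l + f s) p+g≡m ⟩
      f (suc m) + f s        ∎
      where
      wpsg : w (p + s + g) ≢ 0
      wpsg = nonzero (p + g) (trans (cong w p+g≡m) wm) ∘ trans (cong w (swap p g))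
      0<g : ∀ {g} → Gap g → 0 < g
      0<g (inj₁ refl) = s≤s z≤n
      0<g (inj₂ refl) = s≤s z≤n
      p<m : p < suc m
      p<m = subst (p <_) p+g≡m (m<m+n p (0<g gap))

  -- Nim options in the image word

  start-small : ∀ i → i < k → f (suc i) ≡ suc (suc i)
  start-small i i<k = trans (start-after-zero 0 i w0≡0 i<k) (cong (suc ∘ suc) (+-identityʳ i))

  phi-ramp : ∀ p v → Ramp p v → v < k → ∀ j → j ≤ suc v → φ (j + f p) ≡ j
  phi-ramp p v ramp v<k zero _ = phiWord-start-zero w p (Ramp-zero ramp)
  phi-ramp p v ramp v<k (suc zero) _ = phiWord-suc-start-zero w p (Ramp-zero ramp)
  phi-ramp p v ramp v<k (suc (suc j)) (s≤s j<v) = trans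
    (cong φ (sym (start-after-zero p j (Ramp-zero ramp) (<-trans j<v v<k))))
    (phiWord-start-suc w (p + suc j) j (ramp (suc j) j<v))

  -- A position of the image word is described by the zero `p` below it: letters up to `k` lie on a
  -- ramp starting at `f p`, and the constructor carries this whole ramp so that smaller letters can
  -- be reached along it. The letter `suc k` occurs only as the image of `k`.
  data Letter : ℕ → Set where
    low  : ∀ p c → w p ≡ 0 → c ≤ k → (∀ j → j ≤ c → φ (j + f p) ≡ j) → Letter (c + f p)
    high : ∀ n → w n ≡ k → φ (f n) ≡ suc k → Letter (f n)

  letterAt : ∀ x → Letter x
  letterAt x with position w x
  ... | second n wn = low n 1 wn (s≤s z≤n) λ
          { zero _ → phiWord-start-zero w n wn ; (suc zero) _ → phiWord-suc-start-zero w n wn ; (suc (suc _)) (s≤s ()) }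
  ... | first n with w<k∨w≡k n
  ...   | inj₂ wk = high n wk (phiWord-start-suc w n (suc h) wk)
  ...   | inj₁ w<k with w n in wn
  ...     | zero = low n 0 wn z≤n λ { zero _ → phiWord-start-zero w n wn }
  ...     | suc v with ramp-down (suc v) n wn w<k
  ...       | p , refl , ramp = subst Letter (sym (start-after-zero p v (Ramp-zero ramp) (<⇒≤ w<k)))
                (low p (suc (suc v)) (Ramp-zero ramp) w<k (phi-ramp p (suc v) ramp w<k))

  Promoted : ℕ → Set
  Promoted x = x ≡ 1 ⊎ ∃ λ s → S s × f s ≡ x

  -- `f` shifts `1, …, k ∸ 1` to `2, …, k`, and the extra element 1 completes the segment up to `k`.
  Promoted-initial : ∀ t → suc t ≤ k → Promoted (suc t)
  Promoted-initial zero _ = inj₁ refl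
  Promoted-initial (suc t) t<k = inj₂ (suc t , initial (suc t) (s≤s z≤n) t<k , start-small t (<⇒≤ t<k))

  phi≢-suc : ∀ y → φ (suc y) ≢ φ y
  phi≢-suc y eq with position w y
  ... | second n wn = firstLetter≢1 (w (suc n)) (begin
    firstLetter (w (suc n))  ≡⟨ sym (phiWord-start w (suc n)) ⟩
    φ (f (suc n))            ≡⟨ cong φ (start-suc-zero w n wn) ⟩
    φ (suc (suc (f n)))      ≡⟨ eq ⟩
    φ (suc (f n))            ≡⟨ phiWord-suc-start-zero w n wn ⟩
    1                        ∎)
    where open ≡-Reasoning
  ... | first n with w n ≟ 0
  ...   | yes wn = contradiction (trans (sym (phiWord-suc-start-zero w n wn)) (trans eq (phiWord-start-zero w n wn))) λ ()
  ...   | no wn = w≢-suc n (firstLetter-injective (begin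
    firstLetter (w (suc n))  ≡⟨ sym (phiWord-start w (suc n)) ⟩
    φ (f (suc n))            ≡⟨ cong φ (start-suc-nonzero w n wn) ⟩
    φ (suc (f n))            ≡⟨ eq ⟩
    φ (f n)                  ≡⟨ phiWord-start w n ⟩
    firstLetter (w n)        ∎))
    where open ≡-Reasoning

  -- Equal letters lie at equal heights on their ramps, so a distance `f s` between them is also the
  -- distance between the ramp starts. By additivity and injectivity of `f`, two equal letters of
  -- `w` would then be `s` apart.
  phi≢-shift : ∀ {s} → S s → ∀ y x → y + f s ≡ x → φ x ≢ φ y
  phi≢-shift {s} Ss y x eq φ≡ with letterAt y | letterAt x
  ... | low p c wp c≤k φp | low q d wq d≤k φq with trans (sym (φq d ≤-refl)) (trans φ≡ (φp c ≤-refl))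
  ...   | refl = w≢-shift p Ss (trans (cong w p+s≡q) (trans wq (sym wp)))
    where
    p+s≡q : p + s ≡ q
    p+s≡q = start-injective w (trans (start-additive Ss p wp) (+-cancelˡ-≡ c _ _ (trans (sym (+-assoc c (f p) (f s))) eq)))
  phi≢-shift Ss y x eq φ≡ | low p c wp c≤k φp | high n wn φn =
    <⇒≢ (s≤s c≤k) (trans (sym (φp c ≤-refl)) (trans (sym φ≡) φn))
  phi≢-shift Ss y x eq φ≡ | high n wn φn | low p c wp c≤k φp =
    <⇒≢ (s≤s c≤k) (trans (sym (φp c ≤-refl)) (trans φ≡ φn))
  phi≢-shift {s} Ss y x eq φ≡ | high m wm _ | high n wn _ =
    w≢-shift m Ss (trans (cong w (suc-injective m+s≡n)) (trans wn (sym wm)))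
    where
    open ≡-Reasoning
    start-suc-k : ∀ l → w l ≡ k → f (suc l) ≡ suc (f l)
    start-suc-k l wl = start-suc-nonzero w l (λ e → contradiction (trans (sym e) wl) λ ())
    -- Additivity holds at zeros only, so both letters `k` are replaced by the zeros right after
    -- them.
    m+s≡n : suc m + s ≡ suc n
    m+s≡n = start-injective w (begin
      f (suc m + s)      ≡⟨ start-additive Ss (suc m) (zero-after-k m wm) ⟩
      f (suc m) + f s    ≡⟨ cong (_+ f s) (start-suc-k m wm) ⟩
      suc (f m) + f s    ≡⟨ cong suc eq ⟩
      suc (f n)          ≡⟨ sym (start-suc-k n wn) ⟩
      f (suc n)          ∎)

  -- Descending the ramp from height `c` to height `j` takes at most `k` steps, and such a step
  -- count is itself in the promoted set.
  option-in-ramp : ∀ p c j → (∀ i → i ≤ j → φ (i + f p) ≡ i) → j < c → c ≤ j + k → Options Promoted φ (c + f p) j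
  option-in-ramp p c j φp j<c c≤j+k with m≤n⇒∃[o]m+o≡n j<c
  ... | t , refl = suc t , Promoted-initial t t<k , ≤-trans t≤c (m≤m+n _ (f p)) , trans (cong φ shift) (φp j ≤-refl)
    where
    open ≡-Reasoning
    t<k : suc t ≤ k
    t<k = +-cancelˡ-≤ j (suc t) k (subst (_≤ j + k) (sym (+-suc j t)) c≤j+k)
    t≤c : suc t ≤ suc j + t
    t≤c = s≤s (m≤n+m t j)
    shift : suc j + t + f p ∸ suc t ≡ j + f p
    shift = begin
      suc j + t + f p ∸ suc t     ≡⟨ cong (λ l → l + f p ∸ suc t) (cong suc (+-comm j t)) ⟩
      suc t + j + f p ∸ suc t     ≡⟨ cong (_∸ suc t) (+-assoc (suc t) j (f p)) ⟩
      suc t + (j + f p) ∸ suc t   ≡⟨ m+n∸m≡n (suc t) (j + f p) ⟩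
      j + f p                     ∎

  phi-options : ∀ x j → j < φ x → Options Promoted φ x j
  phi-options x j j<φ with letterAt x
  ... | low p c wp c≤k φp = option-in-ramp p c j (λ i i≤j → φp i (≤-trans i≤j (<⇒≤ j<c))) j<c (≤-trans c≤k (m≤n+m k j))
    where j<c = subst (j <_) (φp c ≤-refl) j<φ
  -- The start of the ramp is `suc k` steps away, beyond the initial segment. The zero is reached
  -- instead from an option 0 of `k` in `w`, by additivity at that zero.
  phi-options x zero j<φ | high n wn _ with proj₂ (nim n) 0 (subst (0 <_) (sym wn) (s≤s z≤n))
  ... | s , Ss , s≤n , w0 = f s , inj₂ (s , Ss , refl) , m+n≤o⇒n≤o (f (n ∸ s)) (≤-reflexive (sym fn)) , (begin
    φ (f n ∸ f s)              ≡⟨ cong (λ l → φ (l ∸ f s)) fn ⟩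
    φ (f (n ∸ s) + f s ∸ f s)  ≡⟨ cong φ (m+n∸n≡m (f (n ∸ s)) (f s)) ⟩
    φ (f (n ∸ s))              ≡⟨ phiWord-start-zero w (n ∸ s) w0 ⟩
    0                          ∎)
    where
    open ≡-Reasoning
    fn : f n ≡ f (n ∸ s) + f s
    fn = trans (cong f (sym (m∸n+n≡m s≤n))) (start-additive Ss (n ∸ s) w0)
  phi-options x (suc j) j<φ | high n wn φn with ramp-below-k n wn
  ... | p , refl , ramp = subst (λ l → Options Promoted φ l (suc j)) (sym (start-after-zero p (suc h) (Ramp-zero ramp) ≤-refl))
          (option-in-ramp p (suc k) (suc j) (λ i i≤j → phi-ramp p (suc h) ramp ≤-refl i (≤-trans i≤j (s≤s⁻¹ j<1+k))) j<1+k
            (s≤s (m≤n+m k j)))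
    where j<1+k = subst (suc j <_) φn j<φ

  phi-nim : IsNimSeq Promoted φ
  phi-nim x = avoids , phi-options x
    where
    avoids : ¬ Options Promoted φ x (φ x)
    avoids (_ , inj₁ refl , 1≤x , eq) = phi≢-suc (x ∸ 1) (trans (cong φ (m+[n∸m]≡n 1≤x)) (sym eq))
    avoids (_ , inj₂ (s , Ss , refl) , s≤x , eq) = phi≢-shift Ss (x ∸ f s) x (m∸n+n≡m s≤x) (sym eq)

-- Division with remainder

[m+kn]/n≡k : ∀ m k n .{{_ : NonZero n}} → m < n → (m + k * n) / n ≡ k
[m+kn]/n≡k m k n m<n = trans (+-distrib-/-∣ʳ m (divides-refl k)) (cong₂ _+_ (m<n⇒m/n≡0 m<n) (m*n/n≡m k n))

[m+kn]%n≡m : ∀ m k n .{{_ : NonZero n}} → m < n → (m + k * n) % n ≡ m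
[m+kn]%n≡m m k n m<n = trans ([m+kn]%n≡m%n m k n) (m<n⇒m%n≡m m<n)

modP-small : ∀ {r A} → r < A → modP r A ≡ r
modP-small {A = suc _} r<A = m<n⇒m%n≡m r<A

divP-small : ∀ {r A} → r < A → divP r A ≡ 0
divP-small {A = suc _} r<A = m<n⇒m/n≡0 r<A

modP-< : ∀ r {A} → 0 < A → modP r A < A
modP-< r {suc A} _ = m%n<n r (suc A)

data DivModSuc (r A : ℕ) : Set where
  stay  : modP (suc r) A ≡ suc (modP r A) → divP (suc r) A ≡ divP r A → DivModSuc r A
  carry : modP (suc r) A ≡ 0 → divP (suc r) A ≡ suc (divP r A) → modP r A ≡ A ∸ 1 → DivModSuc r A

divMod-suc : ∀ r {A} → 0 < A → DivModSuc r A
divMod-suc r {suc d} _ with m≤n⇒m<n∨m≡n (m%n<n r (suc d))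
... | inj₁ ρ<A = stay
  (trans (cong (_% suc d) (cong suc r≡)) ([m+kn]%n≡m (suc (r % suc d)) (r / suc d) (suc d) ρ<A))
  (trans (cong (_/ suc d) (cong suc r≡)) ([m+kn]/n≡k (suc (r % suc d)) (r / suc d) (suc d) ρ<A))
  where r≡ = m≡m%n+[m/n]*n r (suc d)
... | inj₂ ρ≡A = carry
  (trans (cong (_% suc d) sr≡) ([m+kn]%n≡m 0 (suc (r / suc d)) (suc d) (s≤s z≤n)))
  (trans (cong (_/ suc d) sr≡) ([m+kn]/n≡k 0 (suc (r / suc d)) (suc d) (s≤s z≤n)))
  (suc-injective ρ≡A)
  where
  sr≡ : suc r ≡ suc (r / suc d) * suc d
  sr≡ = trans (cong suc (m≡m%n+[m/n]*n r (suc d))) (cong (_+ (r / suc d) * suc d) ρ≡A)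

-- Digit strings

weigh : (ℕ → ℕ) → List ℕ → ℕ
weigh b []       = 0
weigh b (d ∷ ds) = d * b 0 + weigh (b ∘ suc) ds

dot≡weigh : ∀ b ds N → length ds ≤ N → dot ds (applyUpTo b N) ≡ weigh b ds
dot≡weigh b [] N _ = refl
dot≡weigh b (d ∷ ds) (suc N) (s≤s le) = cong (d * b 0 +_) (dot≡weigh (b ∘ suc) ds N le)

weigh-∷ʳ : ∀ b ds d → weigh b (ds ∷ʳ d) ≡ weigh b ds + d * b (length ds)
weigh-∷ʳ b [] d = +-identityʳ _
weigh-∷ʳ b (e ∷ ds) d = trans (cong (e * b 0 +_) (weigh-∷ʳ (b ∘ suc) ds d)) (sym (+-assoc (e * b 0) _ _))

length-adj : ∀ ds → length (adj ds) ≡ length ds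
length-adj []           = refl
length-adj (zero ∷ _)   = refl
length-adj (suc _ ∷ _)  = refl

adj-++ : ∀ xs ys → 0 < length xs → adj (xs ++ ys) ≡ adj xs ++ ys
adj-++ (zero ∷ _)  ys _ = refl
adj-++ (suc _ ∷ _) ys _ = refl

lastDigit-++ : ∀ xs ys → 0 < length xs → lastDigit (xs ++ ys) ≡ lastDigit xs
lastDigit-++ (_ ∷ _) ys _ = refl

-- With a single digit 0, the second zero could come from `ys`; hence the bound on the length.
ends00-++ : ∀ xs ys → 1 < length xs → ends00 (xs ++ ys) ≡ ends00 xs
ends00-++ (_ ∷ []) ys (s≤s ())
ends00-++ (zero ∷ zero ∷ _)   ys _ = refl
ends00-++ (zero ∷ suc _ ∷ _)  ys _ = refl
ends00-++ (suc _ ∷ _ ∷ _)     ys _ = refl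

ends00⇒1<length : ∀ xs → ends00 xs ≡ true → 1 < length xs
ends00⇒1<length (zero ∷ zero ∷ _) _ = s≤s (s≤s z≤n)

ends00⇒lastDigit≡0 : ∀ xs → ends00 xs ≡ true → lastDigit xs ≡ 0
ends00⇒lastDigit≡0 (zero ∷ zero ∷ _) _ = refl

lastDigit≡suc⇒¬ends00 : ∀ xs {d} → lastDigit xs ≡ suc d → ends00 xs ≡ false
lastDigit≡suc⇒¬ends00 (suc _ ∷ _) _ = refl

nth-++ : ∀ xs ys i {e} → nth xs i ≡ suc e → nth (xs ++ ys) i ≡ suc e
nth-++ (x ∷ xs) ys zero    eq = eq
nth-++ (x ∷ xs) ys (suc i) eq = nth-++ xs ys i eq

nth1≡suc⇒¬ends00 : ∀ xs {e} → nth xs 1 ≡ suc e → ends00 xs ≡ false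
nth1≡suc⇒¬ends00 (zero ∷ suc _ ∷ _) _  = refl
nth1≡suc⇒¬ends00 (suc _ ∷ _ ∷ _)    _  = refl

nth-∷ʳ : ∀ (xs : List ℕ) x → nth (xs ∷ʳ x) (length xs) ≡ x
nth-∷ʳ [] x = refl
nth-∷ʳ (_ ∷ xs) x = nth-∷ʳ xs x

-- Greedy representations

module Greedy (a : ℕ → ℕ) (repSeq : RepSeq a) where

  a0≡1 = proj₁ repSeq
  a-suc = proj₂ repSeq
  b = promo a

  0<a : ∀ i → 0 < a i
  0<a zero    = subst (0 <_) (sym a0≡1) (s≤s z≤n)
  0<a (suc i) = ≤-trans (s≤s z≤n) (a-suc i)

  n<a : ∀ n → n < a n
  n<a zero    = 0<a 0
  n<a (suc n) = ≤-trans (s≤s (n<a n)) (a-suc n)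

  a-mono-≤ : ∀ {i j} → i ≤ j → a i ≤ a j
  a-mono-≤ {j = zero} z≤n = ≤-refl
  a-mono-≤ {j = suc j} i≤j with m≤n⇒m<n∨m≡n i≤j
  ... | inj₁ i<sj = ≤-trans (a-mono-≤ (s≤s⁻¹ i<sj)) (<⇒≤ (a-suc j))
  ... | inj₂ refl = ≤-refl

  -- Representation with a prescribed number `suc i` of digits: `rep a n` is the case `i = top a n`.
  -- Larger `i` adds leading zeros, so `n` and `suc n` can be compared at a common length.
  digits : ℕ → ℕ → List ℕ
  digits i r = reverse (greedyBE a i r)

  digits-zero : ∀ r → digits 0 r ≡ r ∷ []
  digits-zero r rewrite a0≡1 = cong (_∷ []) (n/1≡n r)

  digits-suc : ∀ i r → digits (suc i) r ≡ digits i (modP r (a (suc i))) ∷ʳ divP r (a (suc i))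
  digits-suc i r = unfold-reverse _ (greedyBE a i (modP r (a (suc i))))

  length-digits : ∀ i r → length (digits i r) ≡ suc i
  length-digits zero r = refl
  length-digits (suc i) r rewrite digits-suc i r =
    trans (length-++ (digits i (modP r (a (suc i))))) (trans (cong (_+ 1) (length-digits i _)) (+-comm (suc i) 1))

  0<length-digits : ∀ i r → 0 < length (digits i r)
  0<length-digits i r = subst (0 <_) (sym (length-digits i r)) (s≤s z≤n)

  digits-pad : ∀ i r → r < a (suc i) → digits (suc i) r ≡ digits i r ∷ʳ 0
  digits-pad i r r<a = trans (digits-suc i r) (cong₂ (λ m q → digits i m ∷ʳ q) (modP-small r<a) (divP-small r<a))

  promoAt : ℕ → ℕ → ℕ
  promoAt i r = weigh b (adj (digits i r))

  promoAt-suc : ∀ i r → promoAt (suc i) r ≡ promoAt i (modP r (a (suc i))) + divP r (a (suc i)) * b (suc i)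
  promoAt-suc i r = begin
    weigh b (adj (digits (suc i) r))          ≡⟨ cong (weigh b ∘ adj) (digits-suc i r) ⟩
    weigh b (adj (ds ∷ʳ q))                   ≡⟨ cong (weigh b) (adj-++ ds (q ∷ []) (0<length-digits i _)) ⟩
    weigh b (adj ds ∷ʳ q)                     ≡⟨ weigh-∷ʳ b (adj ds) q ⟩
    weigh b (adj ds) + q * b (length (adj ds)) ≡⟨ cong (λ l → weigh b (adj ds) + q * b l) (trans (length-adj ds) (length-digits i _)) ⟩
    weigh b (adj ds) + q * b (suc i)          ∎
    where
    open ≡-Reasoning
    ds = digits i (modP r (a (suc i)))
    q = divP r (a (suc i))

  -- Independence of leading zeros

  topFrom-upper : ∀ n j → n < a (suc j) → n < a (suc (topFrom a n j))
  topFrom-upper n zero n<a = n<a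
  topFrom-upper n (suc j) n<a with a (suc j) ≤ᵇ n in eq
  ... | true  = n<a
  ... | false = topFrom-upper n j (≰⇒> λ le → subst T eq (≤⇒≤ᵇ le))

  topFrom-minimal : ∀ n j i → n < a (suc i) → topFrom a n j ≤ i
  topFrom-minimal n zero i _ = z≤n
  topFrom-minimal n (suc j) i n<a with a (suc j) ≤ᵇ n in eq
  ... | true  = ≮⇒≥ λ { (s≤s i≤j) → <⇒≱ n<a (≤-trans (a-mono-≤ (s≤s i≤j)) (≤ᵇ⇒≤ (a (suc j)) n (subst T (sym eq) tt))) }
  ... | false = topFrom-minimal n j i n<a

  module _ {X : Set} {n} (G : ℕ → X) (G-pad : ∀ i → n < a (suc i) → G (suc i) ≡ G i) where

    stable-above : ∀ t d → n < a (suc t) → G (d + t) ≡ G t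
    stable-above t zero    n<a = refl
    stable-above t (suc d) n<a = trans (G-pad (d + t) (≤-trans n<a (a-mono-≤ (s≤s (m≤n+m t d))))) (stable-above t d n<a)

    -- `top a n` is the least level whose successor term exceeds `n`, so every other admissible
    -- level is reached from it by padding.
    at-top : ∀ i → n < a (suc i) → G (top a n) ≡ G i
    at-top i n<a[1+i] with m≤n⇒∃[o]m+o≡n (topFrom-minimal n n i n<a[1+i])
    ... | d , eq = trans (sym (stable-above (top a n) d (topFrom-upper n n (<⇒≤ (n<a (suc n))))))
                         (cong G (trans (+-comm d (top a n)) eq))

  promoAt-pad : ∀ r i → r < a (suc i) → promoAt (suc i) r ≡ promoAt i r
  promoAt-pad r i r<a = trans (promoAt-suc i r)
    (trans (cong₂ (λ m q → promoAt i m + q * b (suc i)) (modP-small r<a) (divP-small r<a)) (+-identityʳ _))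

  lastDigit-pad : ∀ r i → r < a (suc i) → lastDigit (digits (suc i) r) ≡ lastDigit (digits i r)
  lastDigit-pad r i r<a = trans (cong lastDigit (digits-pad i r r<a)) (lastDigit-++ (digits i r) _ (0<length-digits i r))

  -- Positivity matters at level 0: padding the single digit 0 would create a second zero.
  ends00-pad : ∀ r i → suc r < a (suc i) → ends00 (digits (suc i) (suc r)) ≡ ends00 (digits i (suc r))
  ends00-pad r zero r<a = trans
    (cong ends00 (trans (digits-pad 0 (suc r) r<a) (cong (_∷ʳ 0) (digits-zero (suc r)))))
    (cong ends00 (sym (digits-zero (suc r))))
  ends00-pad r (suc i) r<a = trans (cong ends00 (digits-pad (suc i) (suc r) r<a))
    (ends00-++ (digits (suc i) (suc r)) _ (subst (1 <_) (sym (length-digits (suc i) (suc r))) (s≤s (s≤s z≤n))))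

  length-promoList : ∀ i → length (promoList a i) ≡ suc i
  length-promoList zero = refl
  length-promoList (suc i) = trans (length-++ (promoList a i)) (trans (cong (_+ 1) (length-promoList i)) (+-comm (suc i) 1))

  promo-suc : ∀ i → b (suc i) ≡ suc (dot (adj (rep a (a (suc i) ∸ 1))) (promoList a i))
  promo-suc i = trans (cong (nth (promoList a (suc i))) (sym (length-promoList i))) (nth-∷ʳ (promoList a i) _)

  promoList≡applyUpTo : ∀ i → promoList a i ≡ applyUpTo b (suc i)
  promoList≡applyUpTo zero = refl
  promoList≡applyUpTo (suc i) =
    trans (cong₂ _∷ʳ_ (promoList≡applyUpTo i) (sym (promo-suc i))) (applyUpTo-∷ʳ b (suc i))

  -- The defining recursion of the promotion, at a common length. It says that the promoted value
  -- grows by exactly one when a carry reaches digit `suc i`.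
  promo-suc-promoAt : ∀ i → b (suc i) ≡ suc (promoAt i (a (suc i) ∸ 1))
  promo-suc-promoAt i = trans (promo-suc i) (cong suc (begin
    dot (adj (rep a m)) (promoList a i)       ≡⟨ cong (dot (adj (rep a m))) (promoList≡applyUpTo i) ⟩
    dot (adj (rep a m)) (applyUpTo b (suc i)) ≡⟨ dot≡weigh b (adj (rep a m)) (suc i) len ⟩
    promoAt (top a m) m                       ≡⟨ at-top (λ j → promoAt j m) (promoAt-pad m) i m<a ⟩
    promoAt i m                               ∎))
    where
    open ≡-Reasoning
    m = a (suc i) ∸ 1
    m<a : m < a (suc i)
    m<a = ≤-reflexive (m+[n∸m]≡n (0<a (suc i)))
    len : length (adj (rep a m)) ≤ suc i
    len = subst (_≤ suc i) (sym (trans (length-adj (rep a m)) (length-digits (top a m) m))) (s≤s (topFrom-minimal m m i m<a))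

  promoAt-0 : ∀ i → promoAt i 0 ≡ 0
  promoAt-0 zero = cong (weigh b ∘ adj) (digits-zero 0)
  promoAt-0 (suc i) = trans (promoAt-pad 0 i (0<a (suc i))) (promoAt-0 i)

  promoF≡promoAt : ∀ n i → n < a (suc i) → promoF a n ≡ promoAt i n
  promoF≡promoAt zero i _ = sym (promoAt-0 i)
  promoF≡promoAt (suc n) i n<a = begin
    dot (adj ds) (map b (upTo (length ds)))  ≡⟨ cong (dot (adj ds)) (map-upTo b (length ds)) ⟩
    dot (adj ds) (applyUpTo b (length ds))   ≡⟨ dot≡weigh b (adj ds) (length ds) (≤-reflexive (length-adj ds)) ⟩
    promoAt (top a (suc n)) (suc n)          ≡⟨ at-top (λ j → promoAt j (suc n)) (promoAt-pad (suc n)) i n<a ⟩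
    promoAt i (suc n)                        ∎
    where
    open ≡-Reasoning
    ds = rep a (suc n)

  ends00-digits-0 : ∀ i → ends00 (digits (suc i) 0) ≡ true
  ends00-digits-0 zero = cong ends00 (trans (digits-pad 0 0 (0<a 1)) (cong (_∷ʳ 0) (digits-zero 0)))
  ends00-digits-0 (suc i) = trans (cong ends00 (digits-pad (suc i) 0 (0<a (suc (suc i)))))
    (trans (ends00-++ (digits (suc i) 0) _ (ends00⇒1<length _ (ends00-digits-0 i))) (ends00-digits-0 i))

  -- Adding one to a digit string

  -- In the increment case `adj` turns the step from 0 to 1 into a jump to 2, which accounts for the
  -- image of length 2. The positive second digit in `wrap` excludes volatility.
  data DigitStep (i r : ℕ) : Set where
    volatile  : ends00 (digits i (suc r)) ≡ true → promoAt i (suc r) ≡ suc (promoAt i r) → DigitStep i r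
    increment : lastDigit (digits i (suc r)) ≡ suc (lastDigit (digits i r)) →
                promoAt i (suc r) ≡ promoAt i r + imageLength (lastDigit (digits i r)) → DigitStep i r
    wrap      : ∀ e → nth (digits i (suc r)) 1 ≡ suc e → lastDigit (digits i (suc r)) ≡ 0 →
                lastDigit (digits i r) ≡ a 1 ∸ 1 → promoAt i (suc r) ≡ suc (promoAt i r) → DigitStep i r

  digitStep : ∀ i r → DigitStep i r
  -- At level 0 the only digit is `r` itself, with no bound, so no carry occurs.
  digitStep zero r = increment lastDigits promos
    where
    lastDigits : lastDigit (digits 0 (suc r)) ≡ suc (lastDigit (digits 0 r))
    lastDigits = trans (cong lastDigit (digits-zero (suc r))) (cong (suc ∘ lastDigit) (sym (digits-zero r)))
    promos : promoAt 0 (suc r) ≡ promoAt 0 r + imageLength (lastDigit (digits 0 r))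
    promos = trans (cong (weigh b ∘ adj) (digits-zero (suc r))) (trans (single r)
      (cong (λ ds → weigh b (adj ds) + imageLength (lastDigit ds)) (sym (digits-zero r))))
      where
      single : ∀ r → weigh b (adj (suc r ∷ [])) ≡ weigh b (adj (r ∷ [])) + imageLength r
      single zero    = refl
      single (suc r) = +-comm 1 _
  digitStep (suc i) r with divMod-suc r (0<a (suc i))
  ... | stay mod-eq div-eq = lift (digitStep i (modP r A))
    where
    open ≡-Reasoning
    A = a (suc i)
    ρ = modP r A
    q = divP r A
    ds-suc : digits (suc i) (suc r) ≡ digits i (suc ρ) ∷ʳ q
    ds-suc = trans (digits-suc i (suc r)) (cong₂ (λ m q → digits i m ∷ʳ q) mod-eq div-eq)
    last-suc : lastDigit (digits (suc i) (suc r)) ≡ lastDigit (digits i (suc ρ))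
    last-suc = trans (cong lastDigit ds-suc) (lastDigit-++ (digits i (suc ρ)) _ (0<length-digits i _))
    last : lastDigit (digits (suc i) r) ≡ lastDigit (digits i ρ)
    last = trans (cong lastDigit (digits-suc i r)) (lastDigit-++ (digits i ρ) _ (0<length-digits i _))
    promo-step : ∀ c → promoAt i (suc ρ) ≡ promoAt i ρ + c → promoAt (suc i) (suc r) ≡ promoAt (suc i) r + c
    promo-step c eq = begin
      promoAt (suc i) (suc r)                ≡⟨ promoAt-suc i (suc r) ⟩
      promoAt i (modP (suc r) A) + divP (suc r) A * b (suc i) ≡⟨ cong₂ (λ m q → promoAt i m + q * b (suc i)) mod-eq div-eq ⟩
      promoAt i (suc ρ) + q * b (suc i)      ≡⟨ cong (_+ q * b (suc i)) eq ⟩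
      promoAt i ρ + c + q * b (suc i)        ≡⟨ +-assoc (promoAt i ρ) c _ ⟩
      promoAt i ρ + (c + q * b (suc i))      ≡⟨ cong (promoAt i ρ +_) (+-comm c _) ⟩
      promoAt i ρ + (q * b (suc i) + c)      ≡⟨ sym (+-assoc (promoAt i ρ) _ c) ⟩
      promoAt i ρ + q * b (suc i) + c        ≡⟨ cong (_+ c) (sym (promoAt-suc i r)) ⟩
      promoAt (suc i) r + c                  ∎
    promo-step-1 : promoAt i (suc ρ) ≡ suc (promoAt i ρ) → promoAt (suc i) (suc r) ≡ suc (promoAt (suc i) r)
    promo-step-1 eq = trans (promo-step 1 (trans eq (+-comm 1 _))) (+-comm _ 1)
    lift : DigitStep i ρ → DigitStep (suc i) r
    lift (volatile e p) = volatile
      (trans (cong ends00 ds-suc) (trans (ends00-++ (digits i (suc ρ)) _ (ends00⇒1<length _ e)) e)) (promo-step-1 p)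
    lift (increment l p) = increment (trans last-suc (trans l (cong suc (sym last))))
      (trans (promo-step _ p) (cong (λ d → promoAt (suc i) r + imageLength d) (sym last)))
    lift (wrap e n1 l0 l p) = wrap e (trans (cong (λ ds → nth ds 1) ds-suc) (nth-++ (digits i (suc ρ)) _ 1 n1))
      (trans last-suc l0) (trans last l) (promo-step-1 p)
  ... | carry mod-eq div-eq mod-r = finish i refl
    where
    open ≡-Reasoning
    A = a (suc i)
    q = divP r A
    promos : promoAt (suc i) (suc r) ≡ suc (promoAt (suc i) r)
    promos = begin
      promoAt (suc i) (suc r)                ≡⟨ promoAt-suc i (suc r) ⟩
      promoAt i (modP (suc r) A) + divP (suc r) A * b (suc i) ≡⟨ cong₂ (λ m q → promoAt i m + q * b (suc i)) mod-eq div-eq ⟩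
      promoAt i 0 + suc q * b (suc i)        ≡⟨ cong (_+ suc q * b (suc i)) (promoAt-0 i) ⟩
      b (suc i) + q * b (suc i)              ≡⟨ cong (_+ q * b (suc i)) (promo-suc-promoAt i) ⟩
      suc (promoAt i (A ∸ 1) + q * b (suc i)) ≡⟨ cong (λ m → suc (promoAt i m + q * b (suc i))) (sym mod-r) ⟩
      suc (promoAt i (modP r A) + q * b (suc i)) ≡⟨ cong suc (sym (promoAt-suc i r)) ⟩
      suc (promoAt (suc i) r)                ∎
    ds-suc : digits (suc i) (suc r) ≡ digits i 0 ∷ʳ suc q
    ds-suc = trans (digits-suc i (suc r)) (cong₂ (λ m q → digits i m ∷ʳ q) mod-eq div-eq)
    -- After the carry all digits below the top are 0. With one such digit, the second digit is
    -- `suc q`; with two or more, the string ends in two zeros.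
    finish : ∀ j → i ≡ j → DigitStep (suc i) r
    finish zero refl = wrap q
      (trans (cong (λ ds → nth ds 1) ds-suc) (cong (λ ds → nth (ds ∷ʳ suc q) 1) (digits-zero 0)))
      (trans (cong lastDigit ds-suc) (cong (λ ds → lastDigit (ds ∷ʳ suc q)) (digits-zero 0)))
      (trans (cong lastDigit (digits-suc 0 r)) (trans (cong (λ ds → lastDigit (ds ∷ʳ q)) (digits-zero (modP r (a 1)))) mod-r))
      promos
    finish (suc j) refl = volatile (trans (cong ends00 ds-suc)
      (trans (ends00-++ (digits (suc j) 0) _ (ends00⇒1<length _ (ends00-digits-0 j))) (ends00-digits-0 j))) promos

  -- From digits to the representation word

  lastDigit-rep : ∀ n i → n < a (suc i) → lastDigit (rep a n) ≡ lastDigit (digits i n)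
  lastDigit-rep n = at-top (λ j → lastDigit (digits j n)) (lastDigit-pad n)

  volatile2≡ends00 : ∀ n i → suc n < a (suc i) → volatile2 a n ≡ ends00 (digits i (suc n))
  volatile2≡ends00 n = at-top (λ j → ends00 (digits j (suc n))) (ends00-pad n)

  lastDigit-digits-suc : ∀ i r → lastDigit (digits (suc i) r) < a 1
  lastDigit-digits-suc zero r = subst (_< a 1) (sym eq) (modP-< r (0<a 1))
    where
    eq : lastDigit (digits 1 r) ≡ modP r (a 1)
    eq = cong lastDigit (trans (digits-suc 0 r) (cong (_∷ʳ divP r (a 1)) (digits-zero (modP r (a 1)))))
  lastDigit-digits-suc (suc i) r = subst (_< a 1)
    (sym (trans (cong lastDigit (digits-suc (suc i) r)) (lastDigit-++ (digits (suc i) ρ) _ (0<length-digits (suc i) ρ))))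
    (lastDigit-digits-suc i ρ)
    where ρ = modP r (a (suc (suc i)))

  lastDigit-rep-< : ∀ n → lastDigit (rep a n) < a 1
  lastDigit-rep-< n = subst (_< a 1) (sym (lastDigit-rep n (suc n) (<-trans (n<1+n n) (<-trans (n<1+n _) (n<a _)))))
    (lastDigit-digits-suc n n)

  repStep : ∀ n → Step (a 1) (repWord a) (lastDigit ∘ rep a) n × promoF a (suc n) ≡ promoF a n + imageLength (repWord a n)
  repStep n = convert (digitStep i n)
    where
    -- Any level works whose next term exceeds `suc n`; this one does because `n < a n` for every
    -- `n`.
    i = suc n
    1<a1 : 1 < a 1
    1<a1 = n<a 1
    n+1<a : suc n < a (suc i)
    n+1<a = <-trans (n<1+n _) (n<a _)
    n<a′ : n < a (suc i)
    n<a′ = <-trans (n<1+n _) n+1<a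
    volatile-eq = volatile2≡ends00 n i n+1<a
    L-eq = lastDigit-rep n i n<a′
    L-suc-eq = lastDigit-rep (suc n) i n+1<a
    promo-eq : ∀ c → promoAt i (suc n) ≡ promoAt i n + c → promoF a (suc n) ≡ promoF a n + c
    promo-eq c eq = trans (promoF≡promoAt (suc n) i n+1<a) (trans eq (cong (_+ c) (sym (promoF≡promoAt n i n<a′))))
    word-volatile : ends00 (digits i (suc n)) ≡ true → repWord a n ≡ a 1
    word-volatile eq rewrite volatile-eq | eq = refl
    word-digit : ends00 (digits i (suc n)) ≡ false → repWord a n ≡ lastDigit (rep a n)
    word-digit eq rewrite volatile-eq | eq = refl
    imageLength-pos : ∀ {v} → 0 < v → 1 ≡ imageLength v
    imageLength-pos (s≤s _) = refl
    convert : DigitStep i n → Step (a 1) (repWord a) (lastDigit ∘ rep a) n × promoF a (suc n) ≡ promoF a n + imageLength (repWord a n)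
    convert (volatile e p) =
      volatile (word-volatile e) (trans L-suc-eq (ends00⇒lastDigit≡0 _ e)) ,
      promo-eq _ (trans p (trans (+-comm 1 _) (cong (promoAt i n +_)
        (imageLength-pos (subst (0 <_) (sym (word-volatile e)) (0<a 1))))))
    convert (increment l p) =
      increment wd (trans L-suc-eq (trans l (cong suc (sym L-eq)))) ,
      promo-eq _ (trans p (cong (λ d → promoAt i n + imageLength d) (sym (trans wd L-eq))))
      where wd = word-digit (lastDigit≡suc⇒¬ends00 _ l)
    convert (wrap e n1 l0 l p) =
      wrap wd (trans (cong suc (trans L-eq l)) (m+[n∸m]≡n (0<a 1))) (trans L-suc-eq l0) ,
      promo-eq _ (trans p (trans (+-comm 1 _) (cong (promoAt i n +_)
        (imageLength-pos (subst (0 <_) (sym (trans wd (trans L-eq l))) (m<n⇒0<n∸m 1<a1))))))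
      where wd = word-digit (nth1≡suc⇒¬ends00 _ n1)

  promoF≡start : ∀ n → promoF a n ≡ start (repWord a) n
  promoF≡start zero = refl
  promoF≡start (suc n) = trans (proj₂ (repStep n)) (cong (_+ imageLength (repWord a n)) (promoF≡start n))

IsNimSeq-resp : ∀ {S T : ℕ → Set} {w} → (∀ {x} → S x → T x) → (∀ {x} → T x → S x) → IsNimSeq S w → IsNimSeq T w
IsNimSeq-resp S⇒T T⇒S nim n =
  (λ (s , Ts , rest) → proj₁ (nim n) (s , T⇒S Ts , rest)) ,
  (λ j j<w → let s , Ss , rest = proj₂ (nim n) j j<w in s , S⇒T Ss , rest)

theoremE5 : (a : ℕ → ℕ) → RepSeq a → (k : ℕ) → a 1 ≡ k →
    (S : ℕ → Set) → (∀ s → S s → 1 ≤ s) → (∀ i → 1 ≤ i → i < k → S i) →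
    IsNimSeq S (repWord a) →
    IsNimSeq (promoSet a S) (phiWord (repWord a))
-- Strict growth from `a 0 ≡ 1` forces `k` to be at least 2, so `k` has the form `suc (suc h)`
-- required by `NimWord`.
theoremE5 a repSeq k a1≡k S positive initial nim with subst (1 <_) a1≡k (Greedy.n<a a repSeq 1)
theoremE5 a repSeq (suc (suc h)) a1≡k S positive initial nim | s≤s (s≤s _) =
  IsNimSeq-resp to from phi-nim
  where
  open Greedy a repSeq
  open NimWord h (repWord a) (lastDigit ∘ rep a) S positive initial nim
    (cong lastDigit (digits-zero 0)) (λ n → subst (lastDigit (rep a n) <_) a1≡k (lastDigit-rep-< n))
    (λ n → subst (λ k → Step k (repWord a) (lastDigit ∘ rep a) n) a1≡k (proj₁ (repStep n)))
  to : ∀ {x} → Promoted x → promoSet a S x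
  to (inj₁ x≡1)             = inj₁ x≡1
  to (inj₂ (s , Ss , fs≡x)) = inj₂ (s , Ss , trans (promoF≡start s) fs≡x)
  from : ∀ {x} → promoSet a S x → Promoted x
  from (inj₁ x≡1)             = inj₁ x≡1
  from (inj₂ (s , Ss , fs≡x)) = inj₂ (s , Ss , trans (sym (promoF≡start s)) fs≡x)
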